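{- For every positive integer $n$, $$a_n\ \le\ \sum_{i=1}^{n}\left(\left\lceil\frac{2(i-1)}{3}\right\rceil+\left\lceil\frac{2(n-i)}{3}\right\rceil\right)!\cdot\left(n-\left\lceil\frac{2(i-1)}{3}\right\rceil-\left\lceil\frac{2(n-i)}{3}\right\rceil\right)!\ .$$
   Context: Places $1,\dots,n$ stand in a row; neighbouring places have distance $1$. At any time at which at least one place is occupied, the distance of an empty place $x$ is $\min|x-y|$ over all occupied places $y$. Persons arrive one after another and each occupies one empty place. Politeness rule: every person except the first (who chooses freely) occupies one of the empty places whose distance is maximal among all empty places at that time. $a_n$ is the number of sequences $(x_1,\dots,x_n)$ (permutations of $\{1,\dots,n\}$, $x_t$ being the place taken by the $t$-th person) in which $n$ persons fill all $n$ places obeying the politeness rule. -}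

module Defs where

open import Data.Fin.Base using (Fin; toℕ)
open import Data.Fin.Properties using (all?; _≟_)
open import Data.Integer.Base as ℤ using (+_)
open import Data.List.Base
  using (List; []; _∷_; [_]; map; take; filter; length; applyUpTo; allFin; cartesianProductWith)
open import Data.List.Extrema.Nat using (min)
open import Data.List.Membership.DecPropositional using (_∉?_)
open import Data.List.Membership.Propositional using (_∈_; _∉_)
open import Data.List.Membership.Propositional.Properties using (∈-cartesianProductWith⁺; ∈-allFin)
open import Data.List.Relation.Unary.Any using (here)
open import Data.List.Relation.Unary.All using ([])
open import Data.List.Relation.Unary.AllPairs using ([]; _∷_)
open import Data.List.Relation.Unary.Unique.Propositional using (Unique)
open import Data.List.Relation.Unary.Unique.Propositional.Properties using (cartesianProductWith⁺; allFin⁺)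
open import Data.Nat.Base using (ℕ; zero; suc; _*_; _≤_; ∣_-_∣)
open import Data.Nat.ListAction using (sum)
open import Data.Nat.Properties using (_≤?_)
open import Data.Product.Base using (_×_)
open import Data.Rational.Unnormalised.Base using (_/_; ceiling)
open import Data.Unit.Base using (⊤; tt)
open import Data.Vec.Base using (Vec; []; _∷_; lookup; toList)
open import Data.Vec.Properties using (∷-injective)
open import Relation.Binary.PropositionalEquality.Core using (refl)
open import Relation.Nullary.Decidable using (Dec; yes; _×-dec_; _→-dec_)

private
  variable
    n : ℕ

-- The places 1, …, n are the elements of Fin n (place p is the element p - 1).

-- dist x y ys is the minimum of |x - z| over the occupied places z in y ∷ ys
-- (the first argument of `min` takes part in the minimum).
dist : Fin n → Fin n → List (Fin n) → ℕ
dist x y ys = min ∣ toℕ x - toℕ y ∣ (map (λ z → ∣ toℕ x - toℕ z ∣) ys)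

MaximalDistance : List (Fin n) → Fin n → Set
MaximalDistance []       x = ⊤  -- the first person chooses freely
MaximalDistance (y ∷ ys) x = ∀ z → z ∉ y ∷ ys → dist z y ys ≤ dist x y ys

PoliteStep : (occupied : List (Fin n)) → Fin n → Set
PoliteStep occupied x = x ∉ occupied × MaximalDistance occupied x

-- Each person takes an empty place, so a polite sequence of length n has
-- pairwise distinct entries, i.e. is a permutation of the n places.
Polite : Vec (Fin n) n → Set
Polite xs = ∀ t → PoliteStep (take (toℕ t) (toList xs)) (lookup xs t)

maximalDistance? : (occupied : List (Fin n)) (x : Fin n) → Dec (MaximalDistance occupied x)
maximalDistance? []       x = yes tt
maximalDistance? (y ∷ ys) x =
  all? λ z → _∉?_ _≟_ z (y ∷ ys) →-dec (dist z y ys ≤? dist x y ys)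

politeStep? : (occupied : List (Fin n)) (x : Fin n) → Dec (PoliteStep occupied x)
politeStep? occupied x = _∉?_ _≟_ x occupied ×-dec maximalDistance? occupied x

polite? : (xs : Vec (Fin n) n) → Dec (Polite xs)
polite? xs = all? λ t → politeStep? (take (toℕ t) (toList xs)) (lookup xs t)

sequences : ∀ n k → List (Vec (Fin n) k)
sequences n zero    = [ [] ]
sequences n (suc k) = cartesianProductWith _∷_ (allFin n) (sequences n k)

-- Every sequence occurs in the enumeration, and occurs only once, so that
-- filtering it by a predicate counts the sequences satisfying the predicate.
∈-sequences : ∀ {k} (xs : Vec (Fin n) k) → xs ∈ sequences n k
∈-sequences []       = here refl
∈-sequences (x ∷ xs) = ∈-cartesianProductWith⁺ _∷_ (∈-allFin x) (∈-sequences xs)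

sequences-unique : ∀ n k → Unique (sequences n k)
sequences-unique n zero    = [] ∷ []
sequences-unique n (suc k) =
  cartesianProductWith⁺ _∷_ ∷-injective (allFin⁺ n) (sequences-unique n k)

a : ℕ → ℕ
a n = length (filter polite? (sequences n n))

-- ⌈ 2k/3 ⌉; the ceiling is a nonnegative integer, and ℤ.∣_∣ only converts it to ℕ.
⌈2_/3⌉ : ℕ → ℕ
⌈2 k /3⌉ = ℤ.∣ ceiling ((+ (2 * k)) / 3) ∣

-- f 1 + f 2 + ⋯ + f n
∑₁ : ℕ → (ℕ → ℕ) → ℕ
∑₁ n f = sum (applyUpTo (λ j → f (suc j)) n)

{-# OPTIONS --safe #-}
module Submission where

-- Call a set of occupied places dominating if every place is occupied or next to an occupied one,
-- and fix a polite sequence with first place i. Let s be the number of persons seated when the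
-- occupied set becomes dominating; they form the first phase. The person who comes when t ≥ 1
-- places are occupied has at most 2t choices, and at most n - t. In the first phase there are also
-- at most 2(s - t): every place of maximal distance must end up occupied or next to one of the
-- s - t coming persons of this phase, and each of these serves at most two such places. As
--   ∏_{1 ≤ t < s} min (2t) (2(s - t)) ≤ s!,
-- the product of the numbers of choices along the sequence is at most s! (n - s)!. No two persons
-- of the first phase are neighbours, so 2s ≤ n + 1; and each block of three places contains one of
-- them, so s ≥ b = 1 + ⌊(i-1)/3⌋ + ⌊(n-i)/3⌋. In this range s! (n - s)! ≤ b! (n - b)!, which is
-- the i-th term of the bound because k - ⌊k/3⌋ = ⌈2k/3⌉. The number of sequences starting at i is
-- at most the largest product of numbers of choices along one of them.

open import Data.Fin.Base using (Fin; zero; suc; toℕ; fromℕ<)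
open import Data.Fin.Properties using (all?; _≟_; toℕ-injective; toℕ<n; toℕ-fromℕ<)
import Data.Integer.Base as ℤ
open import Data.List.Base
  using (List; []; _∷_; [_]; _++_; _∷ʳ_; map; take; filter; length; tabulate; applyUpTo; upTo;
         allFin; cartesianProductWith)
open import Data.List.Extrema.Nat using (argmin-sel; min≤⊤; min≤xs)
open import Data.List.Membership.DecPropositional using (_∈?_)
open import Data.List.Membership.Propositional using (_∈_; _∉_; find; lose)
open import Data.List.Membership.Propositional.Properties
  using (∈-∃++; ∈-++⁺ˡ; ∈-++⁺ʳ; ∈-++⁻; ∈-map⁺; ∈-map⁻; ∈-filter⁺; ∈-filter⁻;
         ∈-upTo⁺; ∈-allFin; ∈-length)
open import Data.List.Properties
  using (length-++; length-++-sucʳ; length-map; length-upTo; length-tabulate; filter-++;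
         filter-none; map-tabulate; ++-identityʳ; ∷ʳ-++)
open import Data.List.Relation.Unary.All as All using (All; []; _∷_)
import Data.List.Relation.Unary.All.Properties as AllP
open import Data.List.Relation.Unary.AllPairs using ([]; _∷_)
open import Data.List.Relation.Unary.Any using (here; there; any?)
open import Data.List.Relation.Unary.Unique.Propositional using (Unique)
open import Data.List.Relation.Unary.Unique.Propositional.Properties
  using (map⁺; ++⁺; filter⁺; allFin⁺)
open import Data.Nat.Base
  using (ℕ; zero; suc; _+_; _*_; _∸_; _⊓_; _≤_; _<_; z≤n; s≤s; s≤s⁻¹;
         pred; _!; ∣_-_∣; _/_; _%_)
open import Data.Nat.Divisibility using (divides-refl)
open import Data.Nat.DivMod using (m≡m%n+[m/n]*n; m/n*n≤m; m%n<n; [m+kn]%n≡m%n; +-distrib-/-∣ʳ; m*n/n≡m)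
open import Data.Nat.ListAction using (sum)
open import Data.Nat.Properties hiding (_≟_)
open import Data.Nat.Solver using (module +-*-Solver)
open import Data.Product.Base using (∃; ∃₂; _×_; _,_; proj₁; proj₂)
open import Data.Rational.Unnormalised.Base as ℚᵘ using (ceiling)
open import Data.Sum.Base using (_⊎_; inj₁; inj₂; [_,_]′)
open import Data.Vec.Base using (Vec; []; _∷_; lookup; toList)
open import Function.Base using (_∘_; id)
open import Relation.Binary.Definitions using (tri<; tri≈; tri>)
open import Relation.Binary.PropositionalEquality
  using (_≡_; _≢_; refl; sym; trans; cong; cong₂; subst; module ≡-Reasoning)
open import Relation.Nullary.Decidable using (Dec; yes; no; _×-dec_; map′)
open import Relation.Nullary.Negation using (¬_; contradiction)
open import Relation.Unary using (Pred; Decidable)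
open import Level using (0ℓ)

open import Defs

private
  variable
    n : ℕ
    A B C : Set

-- Counting lists

length-∷ʳ : (xs : List A) (x : A) → length (xs ∷ʳ x) ≡ suc (length xs)
length-∷ʳ xs x = trans (length-++ xs) (+-comm (length xs) 1)

unique-⊆⇒length-≤ : {xs ys : List A} → Unique xs → (∀ {x} → x ∈ xs → x ∈ ys) → length xs ≤ length ys
unique-⊆⇒length-≤ []                  xs⊆ys = z≤n
unique-⊆⇒length-≤ {xs = x ∷ xs} (x∉xs ∷ xs!) xs⊆ys
  with us , vs , refl ← ∈-∃++ (xs⊆ys (here refl)) = begin
    suc (length xs)              ≤⟨ s≤s (unique-⊆⇒length-≤ xs! xs⊆us++vs) ⟩
    suc (length (us ++ vs))      ≡⟨ length-++-sucʳ us x vs ⟨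
    length (us ++ x ∷ vs)        ∎
  where
  open ≤-Reasoning
  xs⊆us++vs : ∀ {y} → y ∈ xs → y ∈ us ++ vs
  xs⊆us++vs y∈xs with ∈-++⁻ us (xs⊆ys (there y∈xs))
  ... | inj₁ y∈us         = ∈-++⁺ˡ y∈us
  ... | inj₂ (there y∈vs) = ∈-++⁺ʳ us y∈vs
  ... | inj₂ (here refl)  = contradiction refl (All.lookup x∉xs y∈xs)

-- Every `y` contributes two values `u`, `v`; the values of `f` on `xs` are distinct and all occur
-- among these. The count takes place in `C` rather than in `A`, because in the applications a value
-- such as `toℕ w + d` may lie outside the row.
length-cover : {xs : List A} {ys : List B} {R : B → A → Set} {f : A → C} →
               (∀ {x x′} → f x ≡ f x′ → x ≡ x′) → Unique xs →
               (∀ {x} → x ∈ xs → ∃ λ y → y ∈ ys × R y x) →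
               (∀ {y} → y ∈ ys → ∃₂ λ u v → ∀ {x} → x ∈ xs → R y x → f x ≡ u ⊎ f x ≡ v) →
               length xs ≤ 2 * length ys
length-cover {A} {B} {C} {xs} {ys} {R} {f} f-inj xs! covered atMostTwo =
  let zs , |zs| , f∈zs = values ys atMostTwo in begin
    length xs            ≡⟨ length-map f xs ⟨
    length (map f xs)    ≤⟨ unique-⊆⇒length-≤ (map⁺ f-inj xs!) (images f∈zs) ⟩
    length zs            ≡⟨ |zs| ⟩
    2 * length ys        ∎
  where
  open ≤-Reasoning
  values : (ys : List B) →
           (∀ {y} → y ∈ ys → ∃₂ λ u v → ∀ {x} → x ∈ xs → R y x → f x ≡ u ⊎ f x ≡ v) →
           ∃ λ zs → length zs ≡ 2 * length ys ×
             (∀ {x y} → x ∈ xs → y ∈ ys → R y x → f x ∈ zs)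
  values []       two = [] , refl , λ _ ()
  values (y ∷ ys) two with values ys (two ∘ there) | two (here refl)
  ... | zs , |zs| , f∈zs | u , v , uv =
    u ∷ v ∷ zs , trans (cong (2 +_) |zs|) (sym (*-suc 2 (length ys))) , mem
    where
    mem : ∀ {x y′} → x ∈ xs → y′ ∈ y ∷ ys → R y′ x → f x ∈ u ∷ v ∷ zs
    mem x∈xs (there y∈ys) r = there (there (f∈zs x∈xs y∈ys r))
    mem x∈xs (here refl)  r = [ here , there ∘ here ]′ (uv x∈xs r)
  images : ∀ {zs} → (∀ {x y} → x ∈ xs → y ∈ ys → R y x → f x ∈ zs) →
           ∀ {z} → z ∈ map f xs → z ∈ zs
  images f∈zs z∈ with x , x∈xs , refl ← ∈-map⁻ f z∈ =
    let y , y∈ys , r = covered x∈xs in f∈zs x∈xs y∈ys r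

length-filter-map : {P : Pred B 0ℓ} (P? : Decidable P) (f : A → B) (xs : List A) →
                    length (filter P? (map f xs)) ≡ length (filter (λ x → P? (f x)) xs)
length-filter-map P? f []       = refl
length-filter-map P? f (x ∷ xs) with P? (f x)
... | yes _ = cong suc (length-filter-map P? f xs)
... | no  _ = length-filter-map P? f xs

length-filter-product : {P : Pred C 0ℓ} (P? : Decidable P) (f : A → B → C) (xs : List A) (ys : List B) →
                        length (filter P? (cartesianProductWith f xs ys)) ≡
                        sum (map (λ x → length (filter (λ y → P? (f x y)) ys)) xs)
length-filter-product P? f []       ys = refl
length-filter-product P? f (x ∷ xs) ys = begin
  length (filter P? (map (f x) ys ++ zs))
    ≡⟨ cong length (filter-++ P? (map (f x) ys) zs) ⟩
  length (filter P? (map (f x) ys) ++ filter P? zs)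
    ≡⟨ length-++ (filter P? (map (f x) ys)) ⟩
  length (filter P? (map (f x) ys)) + length (filter P? zs)
    ≡⟨ cong₂ _+_ (length-filter-map P? (f x) ys) (length-filter-product P? f xs ys) ⟩
  length (filter (λ y → P? (f x y)) ys) + sum (map (λ x → length (filter (λ y → P? (f x y)) ys)) xs) ∎
  where
  open ≡-Reasoning
  zs = cartesianProductWith f xs ys

-- Only the terms with `P` contribute, each at most `K` after weighting. The weight `w` multiplies
-- the left side so that `K` need not be divided.
sum-filter-≤ : {P : Pred A 0ℓ} (P? : Decidable P) (f : A → ℕ) (w K : ℕ) →
               (∀ x → P x → w * f x ≤ K) → (∀ x → ¬ P x → f x ≡ 0) →
               ∀ xs → w * sum (map f xs) ≤ length (filter P? xs) * K
sum-filter-≤ P? f w K bound vanish []       = ≤-reflexive (*-zeroʳ w)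
sum-filter-≤ P? f w K bound vanish (x ∷ xs) with ih ← sum-filter-≤ P? f w K bound vanish xs | P? x
... | yes p = ≤-trans (≤-reflexive (*-distribˡ-+ w (f x) _)) (+-mono-≤ (bound x p) ih)
... | no ¬p = subst (λ m → w * (m + sum (map f xs)) ≤ _) (sym (vanish x ¬p)) ih

sum-map-mono : {f g : A → ℕ} → (∀ x → f x ≤ g x) → ∀ xs → sum (map f xs) ≤ sum (map g xs)
sum-map-mono f≤g []       = z≤n
sum-map-mono f≤g (x ∷ xs) = +-mono-≤ (f≤g x) (sum-map-mono f≤g xs)

map-toℕ-allFin : (f : ℕ → A) (n : ℕ) → map (f ∘ toℕ) (allFin n) ≡ applyUpTo f n
map-toℕ-allFin f n = trans (map-tabulate id (f ∘ toℕ)) (go f n)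
  where
  go : (f : ℕ → A) (n : ℕ) → tabulate {n = n} (f ∘ toℕ) ≡ applyUpTo f n
  go f zero    = refl
  go f (suc n) = cong (f 0 ∷_) (go (f ∘ suc) n)

-- Arithmetic

-- The double factorial (2m)!!
evens : ℕ → ℕ
evens zero    = 1
evens (suc m) = 2 * suc m * evens m

-- Since (2m)!! ≤ (2m+1)!!, the first product is at most (2m)!! (2m+1)!! = (2m+1)!, and the second
-- is at most (2m+1)!! (2m+2)!! = (2m+2)!. The two bounds alternate in one induction, which peels
-- off the largest even factor.
evens*evens≤! : ∀ m → evens m * evens m ≤ suc (m + m) !
evens*evens-suc≤! : ∀ m → evens m * evens (suc m) ≤ suc (m + suc m) !

evens*evens≤! zero    = ≤-refl
evens*evens≤! (suc m) = begin
  2 * suc m * evens m * evens (suc m)     ≡⟨ *-assoc (2 * suc m) (evens m) _ ⟩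
  2 * suc m * (evens m * evens (suc m))   ≤⟨ *-mono-≤ 2[1+m]≤ (evens*evens-suc≤! m) ⟩
  suc (suc m + suc m) * suc (m + suc m) ! ∎
  where
  open ≤-Reasoning
  2[1+m]≤ : 2 * suc m ≤ suc (suc m + suc m)
  2[1+m]≤ = ≤-trans (≤-reflexive (cong (suc m +_) (+-identityʳ (suc m)))) (n≤1+n _)

evens*evens-suc≤! m = begin
  evens m * (2 * suc m * evens m)         ≡⟨ x∙yz≈y∙xz (evens m) (2 * suc m) (evens m) ⟩
  2 * suc m * (evens m * evens m)         ≤⟨ *-mono-≤ 2[1+m]≤ (evens*evens≤! m) ⟩
  suc (suc (m + m)) * suc (m + m) !       ≡⟨ cong (λ k → suc k !) (+-suc m m) ⟨
  suc (m + suc m) !                       ∎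
  where
  open ≤-Reasoning
  open import Algebra.Properties.CommutativeSemigroup *-commutativeSemigroup using (x∙yz≈y∙xz)
  2[1+m]≤ : 2 * suc m ≤ suc (suc (m + m))
  2[1+m]≤ = ≤-reflexive (trans (cong (suc m +_) (+-identityʳ (suc m))) (cong suc (+-suc m m)))

-- Bounds the product of the numbers of choices when t places are occupied and the first phase
-- has r persons to come.
pyramid : ℕ → ℕ → ℕ
pyramid t zero    = 1
pyramid t (suc r) = ((2 * t) ⊓ (2 * suc r)) * pyramid (suc t) r

pyramid≤evens : ∀ t r → pyramid t r ≤ evens r
pyramid≤evens t zero    = ≤-refl
pyramid≤evens t (suc r) = *-mono-≤ (m⊓n≤n (2 * t) (2 * suc r)) (pyramid≤evens (suc t) r)

-- While `t` is small, `2 * suc t` is taken from the minimum and turns `evens t` into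
-- `evens (suc t)`. Then `t` grows and `r` shrinks, so their difference drops by two and reaches 0
-- or 1. There the rest of the pyramid is at most `evens r`, which leaves two equal or consecutive
-- double factorials.
evens*pyramid≤! : ∀ t r → t ≤ r → evens t * pyramid (suc t) r ≤ suc (t + r) !
evens*pyramid≤! t r t≤r with m≤n⇒m<n∨m≡n t≤r
... | inj₂ refl = ≤-trans (*-monoʳ-≤ (evens t) (pyramid≤evens (suc t) t)) (evens*evens≤! t)
evens*pyramid≤! t (suc r) _ | inj₁ (s≤s t≤r) with m≤n⇒m<n∨m≡n t≤r
... | inj₂ refl =
  ≤-trans (*-monoʳ-≤ (evens t) (pyramid≤evens (suc t) (suc t))) (evens*evens-suc≤! t)
... | inj₁ t<r = begin
  evens t * (((2 * suc t) ⊓ (2 * suc r)) * p)  ≤⟨ *-monoʳ-≤ (evens t) (*-monoˡ-≤ p (m⊓n≤m (2 * suc t) (2 * suc r))) ⟩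
  evens t * (2 * suc t * p)                ≡⟨ x∙yz≈yx∙z (evens t) (2 * suc t) p ⟩
  2 * suc t * evens t * p                  ≤⟨ evens*pyramid≤! (suc t) r t<r ⟩
  suc (suc t + r) !                        ≡⟨ cong (λ k → suc k !) (+-suc t r) ⟨
  suc (t + suc r) !                        ∎
  where
  open ≤-Reasoning
  open import Algebra.Properties.CommutativeSemigroup *-commutativeSemigroup using (x∙yz≈yx∙z)
  p = pyramid (suc (suc t)) r

pyramid≤! : ∀ r → pyramid 1 r ≤ suc r !
pyramid≤! r = ≤-trans (≤-reflexive (sym (*-identityˡ _))) (evens*pyramid≤! 0 r z≤n)

-- The product is n! divided by the binomial coefficient of n over s, which does not decrease up to
-- the middle. Going down from `suc s` to `s` replaces the factor `suc s` by `n ∸ s`, and 2(s+1) ≤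
-- n+1 says exactly that s+1 ≤ n-s.
factorials-antitone : ∀ {n b} s → b ≤ s → 2 * s ≤ suc n → s ! * (n ∸ s) ! ≤ b ! * (n ∸ b) !
factorials-antitone {n} {b} s b≤s 2s≤1+n with m≤n⇒m<n∨m≡n b≤s
... | inj₂ refl = ≤-refl
factorials-antitone {n} {b} (suc s) _ 2s≤1+n | inj₁ (s≤s b≤s) = begin
  suc s * s ! * (n ∸ suc s) !    ≡⟨ xy∙z≈y∙xz (suc s) (s !) _ ⟩
  s ! * (suc s * (n ∸ suc s) !)  ≤⟨ *-monoʳ-≤ (s !) (*-monoˡ-≤ _ 1+s≤n∸s) ⟩
  s ! * (suc (n ∸ suc s) * (n ∸ suc s) !)  ≡⟨ cong (λ k → s ! * k !) suc-n∸suc-s ⟩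
  s ! * (n ∸ s) !                ≤⟨ factorials-antitone s b≤s (≤-trans (*-monoʳ-≤ 2 (n≤1+n s)) 2s≤1+n) ⟩
  b ! * (n ∸ b) !                ∎
  where
  open ≤-Reasoning
  open import Algebra.Properties.CommutativeSemigroup *-commutativeSemigroup using (xy∙z≈y∙xz)
  s+1+s≤n : s + suc s ≤ n
  s+1+s≤n = s≤s⁻¹ (subst (_≤ suc n) (cong (suc s +_) (+-identityʳ (suc s))) 2s≤1+n)
  suc-n∸suc-s : suc (n ∸ suc s) ≡ n ∸ s
  suc-n∸suc-s = sym (+-∸-assoc 1 (≤-trans (m≤n+m (suc s) s) s+1+s≤n))
  1+s≤n∸s : suc s ≤ suc (n ∸ suc s)
  1+s≤n∸s = subst (suc s ≤_) (sym suc-n∸suc-s) (m+n≤o⇒m≤o∸n (suc s) (subst (_≤ n) (+-comm s (suc s)) s+1+s≤n))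

-- Ceilings of two thirds

-- `ceiling` is minus the floor of the negated fraction, and integer division of a negative number
-- branches on the remainder; hence the case split on `suc m % 3`, here and in the inexact case.
∣ceiling∣-exact : ∀ m → m % 3 ≡ 0 → ℤ.∣ ceiling ((ℤ.+ m) ℚᵘ./ 3) ∣ ≡ m / 3
∣ceiling∣-exact zero    _  = refl
∣ceiling∣-exact (suc m) eq with suc m % 3
... | zero with suc m / 3
...   | zero  = refl
...   | suc q = cong suc (+-identityʳ _)

∣ceiling∣-inexact : ∀ m → m % 3 ≢ 0 → ℤ.∣ ceiling ((ℤ.+ m) ℚᵘ./ 3) ∣ ≡ suc (m / 3)
∣ceiling∣-inexact zero    m%3≢0 = contradiction refl m%3≢0
∣ceiling∣-inexact (suc m) m%3≢0 with suc m % 3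
... | zero  = contradiction refl m%3≢0
... | suc _ = cong suc (+-identityʳ _)

-- Doubling gives 2r + 6q: the part 6q yields exactly 2q, and ⌈2r/3⌉ = r for r = 0, 1, 2.
⌈2k/3⌉-divMod : ∀ r q → r < 3 → ⌈2 (r + q * 3) /3⌉ ≡ r + (q + q)
⌈2k/3⌉-divMod r q r<3 = begin
  ⌈2 (r + q * 3) /3⌉                                   ≡⟨ cong (λ m → ℤ.∣ ceiling ((ℤ.+ m) ℚᵘ./ 3) ∣) double ⟩
  ℤ.∣ ceiling ((ℤ.+ (2 * r + (q + q) * 3)) ℚᵘ./ 3) ∣   ≡⟨ value r r<3 ⟩
  r + (q + q)                                          ∎
  where
  open ≡-Reasoning
  double : 2 * (r + q * 3) ≡ 2 * r + (q + q) * 3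
  double = solve 2 (λ r q → con 2 :* (r :+ q :* con 3) := con 2 :* r :+ (q :+ q) :* con 3) refl r q
    where open +-*-Solver
  rem : ∀ m → (m + (q + q) * 3) % 3 ≡ m % 3
  rem m = [m+kn]%n≡m%n m (q + q) 3
  quot : ∀ m → (m + (q + q) * 3) / 3 ≡ m / 3 + (q + q)
  quot m = trans (+-distrib-/-∣ʳ m (divides-refl (q + q))) (cong (m / 3 +_) (m*n/n≡m (q + q) 3))
  value : ∀ r → r < 3 → ℤ.∣ ceiling ((ℤ.+ (2 * r + (q + q) * 3)) ℚᵘ./ 3) ∣ ≡ r + (q + q)
  value 0 _ = trans (∣ceiling∣-exact ((q + q) * 3) (rem 0)) (quot 0)
  value 1 _ = trans (∣ceiling∣-inexact (2 + (q + q) * 3) (λ eq → contradiction (trans (sym (rem 2)) eq) λ ())) (cong suc (quot 2))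
  value 2 _ = trans (∣ceiling∣-inexact (4 + (q + q) * 3) (λ eq → contradiction (trans (sym (rem 4)) eq) λ ())) (cong suc (quot 4))
  value (suc (suc (suc _))) (s≤s (s≤s (s≤s ())))

⌈2k/3⌉+k/3≡k : ∀ k → ⌈2 k /3⌉ + k / 3 ≡ k
⌈2k/3⌉+k/3≡k k = begin
  ⌈2 k /3⌉ + q            ≡⟨ cong (λ m → ⌈2 m /3⌉ + q) (m≡m%n+[m/n]*n k 3) ⟩
  ⌈2 (r + q * 3) /3⌉ + q  ≡⟨ cong (_+ q) (⌈2k/3⌉-divMod r q (m%n<n k 3)) ⟩
  r + (q + q) + q         ≡⟨ solve 2 (λ r q → r :+ (q :+ q) :+ q := r :+ q :* con 3) refl r q ⟩
  r + q * 3               ≡⟨ m≡m%n+[m/n]*n k 3 ⟨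
  k                       ∎
  where
  open ≡-Reasoning
  open +-*-Solver
  r = k % 3
  q = k / 3

-- Distances

-- Kept as two inequalities because the argument with blocks of three uses each of them separately.
Near : ℕ → ℕ → Set
Near x y = x ≤ suc y × y ≤ suc x

near? : ∀ x y → Dec (Near x y)
near? x y = (x ≤? suc y) ×-dec (y ≤? suc x)

near-sym : ∀ {x y} → Near x y → Near y x
near-sym (p , q) = q , p

near-refl : ∀ x → Near x x
near-refl x = n≤1+n x , n≤1+n x

near-cases : ∀ {x y} → Near x y → x ≡ y ⊎ x ≡ suc y ⊎ suc x ≡ y
near-cases (x≤1+y , y≤1+x) with m≤n⇒m<n∨m≡n x≤1+y | m≤n⇒m<n∨m≡n y≤1+x
... | inj₂ x≡1+y     | _               = inj₂ (inj₁ x≡1+y)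
... | inj₁ _         | inj₂ y≡1+x      = inj₂ (inj₂ (sym y≡1+x))
... | inj₁ (s≤s x≤y) | inj₁ (s≤s y≤x) = inj₁ (≤-antisym x≤y y≤x)

∣-∣≤1⇒near : ∀ x y → ∣ x - y ∣ ≤ 1 → Near x y
∣-∣≤1⇒near zero          y             d≤1 = z≤n , d≤1
∣-∣≤1⇒near (suc x)       zero          d≤1 = d≤1 , z≤n
∣-∣≤1⇒near (suc x)       (suc y)       d≤1 = let p , q = ∣-∣≤1⇒near x y d≤1 in s≤s p , s≤s q

near⇒∣-∣≤1 : ∀ x y → Near x y → ∣ x - y ∣ ≤ 1
near⇒∣-∣≤1 zero    y       (_ , p)           = p
near⇒∣-∣≤1 (suc x) zero    (p , _)           = p
near⇒∣-∣≤1 (suc x) (suc y) (s≤s p , s≤s q) = near⇒∣-∣≤1 x y (p , q)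

step-up-closer : ∀ {x y} → x < y → ∣ suc x - y ∣ < ∣ x - y ∣
step-up-closer {zero}  {suc y} _         = ≤-refl
step-up-closer {suc x} {suc y} (s≤s x<y) = step-up-closer x<y

step-down-closer : ∀ {x y} → y ≤ x → ∣ x - y ∣ < ∣ suc x - y ∣
step-down-closer {x}     {zero}  _         = s≤s (≤-reflexive (∣-∣-identityʳ x))
step-down-closer {suc x} {suc y} (s≤s y≤x) = step-down-closer y≤x

∣x-y∣≡d⇒ : ∀ x y {d} → ∣ x - y ∣ ≡ d → x ≡ y + d ⊎ x ≡ y ∸ d
∣x-y∣≡d⇒ x y refl with ≤-total y x
... | inj₁ y≤x = inj₁ (sym (trans (cong (y +_) (m≤n⇒∣n-m∣≡n∸m y≤x)) (m+[n∸m]≡n y≤x)))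
... | inj₂ x≤y = inj₂ (sym (trans (cong (y ∸_) (m≤n⇒∣m-n∣≡n∸m x≤y)) (m∸[m∸n]≡n x≤y)))

dist≤ : ∀ (x y : Fin n) ys {w} → w ∈ y ∷ ys → dist x y ys ≤ ∣ toℕ x - toℕ w ∣
dist≤ x y ys (here refl)  = min≤⊤ _ (map (λ z → ∣ toℕ x - toℕ z ∣) ys)
dist≤ x y ys (there w∈ys) = All.lookup (min≤xs ∣ toℕ x - toℕ y ∣ _) (∈-map⁺ (λ z → ∣ toℕ x - toℕ z ∣) w∈ys)

dist-attained : ∀ (x y : Fin n) ys → ∃ λ w → w ∈ y ∷ ys × dist x y ys ≡ ∣ toℕ x - toℕ w ∣
dist-attained x y ys with argmin-sel id ∣ toℕ x - toℕ y ∣ (map (λ z → ∣ toℕ x - toℕ z ∣) ys)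
... | inj₁ d≡ = y , here refl , d≡
... | inj₂ d∈ with w , w∈ys , d≡ ← ∈-map⁻ (λ z → ∣ toℕ x - toℕ z ∣) d∈ = w , there w∈ys , d≡

-- Dominating configurations

Dominating : List (Fin n) → Set
Dominating {n} occ = ∀ (z : Fin n) → ∃ λ y → y ∈ occ × Near (toℕ z) (toℕ y)

dominating? : (occ : List (Fin n)) → Dec (Dominating occ)
dominating? occ = map′ (λ dom z → find (dom z)) (λ dom z → let _ , y∈ , r = dom z in lose y∈ r)
                       (all? λ z → any? (λ y → near? (toℕ z) (toℕ y)) occ)

NoNeighbours : List (Fin n) → Set
NoNeighbours occ = ∀ {x y} → x ∈ occ → y ∈ occ → toℕ x ≢ suc (toℕ y)

-- occ and its translate by 1 are disjoint subsets of {0, …, n}.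
noNeighbours⇒2*length≤ : {occ : List (Fin n)} → Unique occ → NoNeighbours occ → 2 * length occ ≤ suc n
noNeighbours⇒2*length≤ {n} {occ} occ! apart = begin
  2 * length occ                  ≡⟨ cong (length occ +_) (+-identityʳ _) ⟩
  length occ + length occ         ≡⟨ cong₂ _+_ (length-map toℕ occ) (length-map (suc ∘ toℕ) occ) ⟨
  length (map toℕ occ) + length (map (suc ∘ toℕ) occ)  ≡⟨ length-++ (map toℕ occ) ⟨
  length (map toℕ occ ++ map (suc ∘ toℕ) occ)          ≤⟨ unique-⊆⇒length-≤ all! ⊆upTo ⟩
  length (upTo (suc n))           ≡⟨ length-upTo (suc n) ⟩
  suc n                           ∎
  where
  open ≤-Reasoning
  all! : Unique (map toℕ occ ++ map (suc ∘ toℕ) occ)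
  all! = ++⁺ (map⁺ toℕ-injective occ!) (map⁺ (toℕ-injective ∘ suc-injective) occ!) disjoint
    where
    disjoint : ∀ {v} → ¬ (v ∈ map toℕ occ × v ∈ map (suc ∘ toℕ) occ)
    disjoint (v∈ , v∈′) with x , x∈ , refl ← ∈-map⁻ toℕ v∈ | y , y∈ , x≡1+y ← ∈-map⁻ (suc ∘ toℕ) v∈′ =
      apart x∈ y∈ x≡1+y
  ⊆upTo : ∀ {v} → v ∈ map toℕ occ ++ map (suc ∘ toℕ) occ → v ∈ upTo (suc n)
  ⊆upTo v∈ with ∈-++⁻ (map toℕ occ) v∈
  ... | inj₁ v∈ˡ with x , _ , refl ← ∈-map⁻ toℕ v∈ˡ = ∈-upTo⁺ (m≤n⇒m≤1+n (toℕ<n x))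
  ... | inj₂ v∈ʳ with x , _ , refl ← ∈-map⁻ (suc ∘ toℕ) v∈ʳ = ∈-upTo⁺ (s≤s (toℕ<n x))

-- The middle place of a block of three is near an occupied place, which then lies in the block.
occupiedInBlock : {occ : List (Fin n)} → Dominating occ → ∀ lo → 3 + lo ≤ n →
                  ∃ λ y → y ∈ occ × lo ≤ toℕ y × toℕ y < 3 + lo
occupiedInBlock dom lo 3+lo≤n with y , y∈occ , near ← dom (fromℕ< (<⇒≤ 3+lo≤n)) =
  let mid≤1+y , y≤1+mid = subst (λ m → Near m (toℕ y)) (toℕ-fromℕ< (<⇒≤ 3+lo≤n)) near in
  y , y∈occ , s≤s⁻¹ mid≤1+y , s≤s y≤1+mid

-- Consecutive blocks of three are disjoint, so each new block yields a place to the right of all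
-- earlier ones. The bounds on the places are carried along to give distinctness, both here and
-- between the two sides of a given place.
occupiedInBlocks : {occ : List (Fin n)} → Dominating occ → ∀ lo q → q * 3 + lo ≤ n →
                   ∃ λ xs → length xs ≡ q × Unique xs ×
                     (∀ {x} → x ∈ xs → x ∈ occ × lo ≤ toℕ x × toℕ x < q * 3 + lo)
occupiedInBlocks dom lo zero    _ = [] , refl , [] , λ ()
occupiedInBlocks dom lo (suc q) 3+hi≤n
  with xs , |xs| , xs! , xs⊆ ← occupiedInBlocks dom lo q (≤-trans (m≤n+m _ 3) 3+hi≤n)
     | y , y∈occ , hi≤y , y<3+hi ← occupiedInBlock dom (q * 3 + lo) 3+hi≤n
  = y ∷ xs , cong suc |xs| , (All.tabulate (λ x∈ y≡x → <⇒≢ (x<y x∈) (cong toℕ (sym y≡x))) ∷ xs!) , λ where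
      (here refl) → y∈occ , ≤-trans (m≤n+m lo (q * 3)) hi≤y , y<3+hi
      (there x∈)  → let x∈occ , lo≤x , x<hi = xs⊆ x∈ in x∈occ , lo≤x , ≤-trans x<hi (m≤n+m _ 3)
  where
  x<y : ∀ {x} → x ∈ xs → toℕ x < toℕ y
  x<y x∈ = ≤-trans (proj₂ (proj₂ (xs⊆ x∈))) hi≤y

leftBlocks≤ : ∀ {k} → k / 3 * 3 + 0 ≤ k
leftBlocks≤ {k} = ≤-trans (≤-reflexive (+-identityʳ _)) (m/n*n≤m k 3)

rightBlocks≤ : {x : Fin n} → (n ∸ suc (toℕ x)) / 3 * 3 + suc (toℕ x) ≤ n
rightBlocks≤ {x = x} = ≤-trans (+-monoˡ-≤ (suc (toℕ x)) (m/n*n≤m _ 3)) (≤-reflexive (m∸n+n≡m (toℕ<n x)))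

-- The blocks are cut from the places left of `x` and from those right of `x`, so that `x` itself
-- counts in addition to one place per block.
dominating⇒length≥ : {occ : List (Fin n)} → Dominating occ → ∀ {x} → x ∈ occ →
                     suc (toℕ x / 3 + (n ∸ suc (toℕ x)) / 3) ≤ length occ
dominating⇒length≥ {n} {occ} dom {x} x∈occ
  with ls , |ls| , ls! , ls⊆ ← occupiedInBlocks dom 0 (toℕ x / 3) (≤-trans (leftBlocks≤ {toℕ x}) (<⇒≤ (toℕ<n x)))
     | rs , |rs| , rs! , rs⊆ ← occupiedInBlocks dom (suc (toℕ x)) ((n ∸ suc (toℕ x)) / 3) (rightBlocks≤ {x = x})
  = begin
  suc (toℕ x / 3 + (n ∸ suc (toℕ x)) / 3)   ≡⟨ cong suc (cong₂ _+_ |ls| |rs|) ⟨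
  suc (length ls + length rs)               ≡⟨ cong suc (length-++ ls) ⟨
  length (x ∷ ls ++ rs)                     ≤⟨ unique-⊆⇒length-≤ (x∉ ∷ ++⁺ ls! rs! disjoint) ⊆occ ⟩
  length occ                                ∎
  where
  open ≤-Reasoning
  l<x : ∀ {l} → l ∈ ls → toℕ l < toℕ x
  l<x l∈ = ≤-trans (proj₂ (proj₂ (ls⊆ l∈))) (leftBlocks≤ {toℕ x})
  x<r : ∀ {r} → r ∈ rs → toℕ x < toℕ r
  x<r r∈ = proj₁ (proj₂ (rs⊆ r∈))
  disjoint : ∀ {v} → ¬ (v ∈ ls × v ∈ rs)
  disjoint (v∈ls , v∈rs) = <-asym (l<x v∈ls) (x<r v∈rs)
  x∉ : All (x ≢_) (ls ++ rs)
  x∉ = All.tabulate λ v∈ x≡v → [ (λ v∈ls → <⇒≢ (l<x v∈ls) (cong toℕ (sym x≡v)))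
                               , (λ v∈rs → <⇒≢ (x<r v∈rs) (cong toℕ x≡v)) ]′ (∈-++⁻ ls v∈)
  ⊆occ : ∀ {v} → v ∈ x ∷ ls ++ rs → v ∈ occ
  ⊆occ (here refl) = x∈occ
  ⊆occ (there v∈)  = [ proj₁ ∘ ls⊆ , proj₁ ∘ rs⊆ ]′ (∈-++⁻ ls v∈)

-- The number of choices of a polite person

candidates : List (Fin n) → List (Fin n)
candidates {n} occ = filter (politeStep? occ) (allFin n)

∈-candidates⁻ : (occ : List (Fin n)) → ∀ {x} → x ∈ candidates occ → PoliteStep occ x
∈-candidates⁻ {n} occ x∈ = proj₂ (∈-filter⁻ (politeStep? occ) {xs = allFin n} x∈)

candidates-unique : (occ : List (Fin n)) → Unique (candidates occ)
candidates-unique {n} occ = filter⁺ (politeStep? occ) (allFin⁺ n)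

choices : List (Fin n) → ℕ
choices occ = length (candidates occ)

choices+occupied≤n : {occ : List (Fin n)} → Unique occ → choices occ + length occ ≤ n
choices+occupied≤n {n} {occ} occ! = begin
  choices occ + length occ          ≡⟨ length-++ (candidates occ) ⟨
  length (candidates occ ++ occ)    ≤⟨ unique-⊆⇒length-≤ all! (λ {x} _ → ∈-allFin x) ⟩
  length (allFin n)                 ≡⟨ length-tabulate id ⟩
  n                                 ∎
  where
  open ≤-Reasoning
  all! : Unique (candidates occ ++ occ)
  all! = ++⁺ (candidates-unique occ) occ! λ (x∈ , x∈occ) → proj₁ (∈-candidates⁻ occ x∈) x∈occ

-- All candidates have the same distance d, and y + d, y - d are the only places at distance d from y.
choices≤2*occupied : (y : Fin n) (ys : List (Fin n)) → choices (y ∷ ys) ≤ 2 * length (y ∷ ys)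
choices≤2*occupied {n} y ys = bound (candidates (y ∷ ys)) (candidates-unique (y ∷ ys)) (∈-candidates⁻ (y ∷ ys))
  where
  -- The list of candidates becomes a variable so that its head, if there is one, can supply the
  -- common distance `d`.
  bound : ∀ cs → Unique cs → (∀ {x} → x ∈ cs → PoliteStep (y ∷ ys) x) → length cs ≤ 2 * length (y ∷ ys)
  bound []       _   _      = z≤n
  bound (c ∷ cs) cs! polite = length-cover {R = λ w x → ∣ toℕ x - toℕ w ∣ ≡ d} toℕ-injective cs!
    (λ {x} x∈ → let w , w∈ , d≡ = dist-attained x y ys in w , w∈ , trans (sym d≡) (same x∈))
    (λ {w} _ → toℕ w + d , toℕ w ∸ d , λ {x} _ → ∣x-y∣≡d⇒ (toℕ x) (toℕ w))
    where
    d = dist c y ys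
    same : ∀ {x} → x ∈ c ∷ cs → dist x y ys ≡ d
    same {x} x∈ = let x∉ , x-max = polite x∈ ; c∉ , c-max = polite (here refl) in
      ≤-antisym (c-max x x∉) (x-max c c∉)

-- A candidate near an occupied place has distance at most 1. By maximality every empty place then
-- has distance at most 1, which is domination.
politeStep-apart : ∀ (y : Fin n) ys {x w} → ¬ Dominating (y ∷ ys) → PoliteStep (y ∷ ys) x →
                   w ∈ y ∷ ys → ¬ Near (toℕ x) (toℕ w)
politeStep-apart y ys {x} {w} ¬dom (_ , x-max) w∈ near = ¬dom dominates
  where
  dominates : Dominating (y ∷ ys)
  dominates z with _∈?_ _≟_ z (y ∷ ys)
  ... | yes z∈ = z , z∈ , near-refl (toℕ z)
  ... | no  z∉ = let v , v∈ , d≡ = dist-attained z y ys in v , v∈ , ∣-∣≤1⇒near (toℕ z) (toℕ v) (begin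
    ∣ toℕ z - toℕ v ∣   ≡⟨ d≡ ⟨
    dist z y ys         ≤⟨ x-max z z∉ ⟩
    dist x y ys         ≤⟨ dist≤ x y ys w∈ ⟩
    ∣ toℕ x - toℕ w ∣   ≤⟨ near⇒∣-∣≤1 (toℕ x) (toℕ w) near ⟩
    1                   ∎)
    where open ≤-Reasoning

-- Every candidate is near a place of us, and a place z is near at most two candidates: the
-- neighbour of z on the side of the nearest occupied place is closer to that place than z is.
choices≤2*remaining : ∀ (y : Fin n) ys us → ¬ Dominating (y ∷ ys) → Dominating (y ∷ ys ++ us) →
                      choices (y ∷ ys) ≤ 2 * length us
choices≤2*remaining {n} y ys us ¬dom dom =
  length-cover {R = λ z x → Near (toℕ x) (toℕ z)} toℕ-injective (candidates-unique occ) covered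
    λ {z} _ → atMostTwo z
  where
  occ = y ∷ ys
  apart : ∀ {x w} → x ∈ candidates occ → w ∈ occ → ¬ Near (toℕ x) (toℕ w)
  apart x∈ = politeStep-apart y ys ¬dom (∈-candidates⁻ occ x∈)
  covered : ∀ {x} → x ∈ candidates occ → ∃ λ z → z ∈ us × Near (toℕ x) (toℕ z)
  covered {x} x∈ with z , z∈ , near ← dom x with ∈-++⁻ occ z∈
  ... | inj₁ z∈occ = contradiction near (apart x∈ z∈occ)
  ... | inj₂ z∈us  = z , z∈us , near
  notCloser : ∀ {x z w} → x ∈ candidates occ → z ∉ occ → w ∈ occ → dist z y ys ≡ ∣ toℕ z - toℕ w ∣ →
              ¬ (∣ toℕ x - toℕ w ∣ < ∣ toℕ z - toℕ w ∣)
  notCloser {x} {z} {w} x∈ z∉ w∈ d≡ closer = <-irrefl refl (begin-strict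
    dist z y ys         ≤⟨ proj₂ (∈-candidates⁻ occ x∈) z z∉ ⟩
    dist x y ys         ≤⟨ dist≤ x y ys w∈ ⟩
    ∣ toℕ x - toℕ w ∣   <⟨ closer ⟩
    ∣ toℕ z - toℕ w ∣   ≡⟨ d≡ ⟨
    dist z y ys         ∎)
    where open ≤-Reasoning
  atMostTwo : ∀ z → ∃₂ λ u v → ∀ {x} → x ∈ candidates occ → Near (toℕ x) (toℕ z) → toℕ x ≡ u ⊎ toℕ x ≡ v
  atMostTwo z with _∈?_ _≟_ z occ
  -- No candidate is near an occupied `z`, so the two values are arbitrary.
  ... | yes z∈ = 0 , 0 , λ x∈ near → contradiction near (apart x∈ z∈)
  ... | no  z∉ with w , w∈ , d≡ ← dist-attained z y ys with <-cmp (toℕ z) (toℕ w)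
  ... | tri≈ _ z≡w _ = contradiction (subst (_∈ occ) (sym (toℕ-injective z≡w)) w∈) z∉
  ... | tri< z<w _ _ = toℕ z , pred (toℕ z) , λ {x} x∈ near → [ inj₁
    , [ (λ x≡1+z → contradiction
          (subst (λ m → ∣ m - toℕ w ∣ < ∣ toℕ z - toℕ w ∣) (sym x≡1+z) (step-up-closer z<w))
          (notCloser {x} {z} x∈ z∉ w∈ d≡))
      , (λ 1+x≡z → inj₂ (cong pred 1+x≡z)) ]′ ]′ (near-cases near)
  ... | tri> _ _ w<z = toℕ z , suc (toℕ z) , λ {x} x∈ near → [ inj₁
    , [ inj₂
      , (λ 1+x≡z → contradiction
          (subst (λ m → ∣ toℕ x - toℕ w ∣ < ∣ m - toℕ w ∣) 1+x≡z
            (step-down-closer (s≤s⁻¹ (subst (toℕ w <_) (sym 1+x≡z) w<z))))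
          (notCloser {x} {z} x∈ z∉ w∈ d≡)) ]′ ]′ (near-cases near)

-- Polite continuations

-- Arrivals are appended at the end, so that the occupied list agrees with the prefixes in `Polite`
-- and its head remains the first person.
data PoliteFrom {n} : List (Fin n) → List (Fin n) → Set where
  []  : ∀ {occ} → PoliteFrom occ []
  _∷_ : ∀ {occ x xs} → PoliteStep occ x → PoliteFrom (occ ∷ʳ x) xs → PoliteFrom occ (x ∷ xs)

-- The run stops at the first dominating moment: `more` records that domination was not reached
-- before this arrival, as `politeStep-apart` and `choices≤2*remaining` require.
data FirstPhase {n} : List (Fin n) → List (Fin n) → Set where
  done : ∀ {occ} → Dominating occ → FirstPhase occ []
  more : ∀ {occ x us} → ¬ Dominating occ → FirstPhase (occ ∷ʳ x) us → FirstPhase occ (x ∷ us)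

branching : List (Fin n) → List (Fin n) → ℕ
branching occ []       = 1
branching occ (x ∷ xs) = choices occ * branching (occ ∷ʳ x) xs

branching-++ : ∀ (occ us vs : List (Fin n)) →
               branching occ (us ++ vs) ≡ branching occ us * branching (occ ++ us) vs
branching-++ occ []       vs =
  trans (cong (λ o → branching o vs) (sym (++-identityʳ occ))) (sym (*-identityˡ _))
branching-++ occ (x ∷ us) vs = begin
  choices occ * branching (occ ∷ʳ x) (us ++ vs)
    ≡⟨ cong (choices occ *_) (branching-++ (occ ∷ʳ x) us vs) ⟩
  choices occ * (branching (occ ∷ʳ x) us * branching (occ ∷ʳ x ++ us) vs)
    ≡⟨ *-assoc (choices occ) _ _ ⟨
  branching occ (x ∷ us) * branching (occ ∷ʳ x ++ us) vs
    ≡⟨ cong (λ o → branching occ (x ∷ us) * branching o vs) (∷ʳ-++ occ x us) ⟩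
  branching occ (x ∷ us) * branching (occ ++ x ∷ us) vs ∎
  where open ≡-Reasoning

politeFrom-++⁻ˡ : ∀ {occ : List (Fin n)} us {vs} → PoliteFrom occ (us ++ vs) → PoliteFrom occ us
politeFrom-++⁻ˡ []       _       = []
politeFrom-++⁻ˡ (x ∷ us) (p ∷ q) = p ∷ politeFrom-++⁻ˡ us q

unique-∷ʳ : {xs : List A} {x : A} → Unique xs → x ∉ xs → Unique (xs ∷ʳ x)
unique-∷ʳ xs! x∉xs = ++⁺ xs! ([] ∷ []) λ where (x∈xs , here refl) → x∉xs x∈xs

politeFrom-unique : ∀ {occ xs : List (Fin n)} → Unique occ → PoliteFrom occ xs → Unique (occ ++ xs)
politeFrom-unique {occ = occ} occ! [] = subst Unique (sym (++-identityʳ occ)) occ!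
politeFrom-unique {occ = occ} {x ∷ xs} occ! ((x∉occ , _) ∷ q) =
  subst Unique (∷ʳ-++ occ x xs) (politeFrom-unique (unique-∷ʳ occ! x∉occ) q)

firstPhase-dominating : ∀ {occ us : List (Fin n)} → FirstPhase occ us → Dominating (occ ++ us)
firstPhase-dominating {occ = occ} (done dom) = subst Dominating (sym (++-identityʳ occ)) dom
firstPhase-dominating {occ = occ} {x ∷ us} (more _ ph) =
  subst Dominating (∷ʳ-++ occ x us) (firstPhase-dominating ph)

firstPhase-split : ∀ (occ xs : List (Fin n)) → Dominating (occ ++ xs) →
                   ∃₂ λ us vs → xs ≡ us ++ vs × FirstPhase occ us
firstPhase-split occ xs dom with dominating? occ
... | yes dom′ = [] , xs , refl , done dom′
firstPhase-split occ []       dom | no ¬dom =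
  contradiction (subst Dominating (++-identityʳ occ) dom) ¬dom
firstPhase-split occ (x ∷ xs) dom | no ¬dom =
  let us , vs , xs≡ , ph = firstPhase-split (occ ∷ʳ x) xs (subst Dominating (sym (∷ʳ-++ occ x xs)) dom) in
  x ∷ us , vs , cong (x ∷_) xs≡ , more ¬dom ph

-- Every person of the phase, the last one included, arrives while the configuration is not yet
-- dominating, and so sits apart from all occupied places by `politeStep-apart`.
firstPhase-noNeighbours : ∀ (y : Fin n) ys {us} → NoNeighbours (y ∷ ys) → PoliteFrom (y ∷ ys) us →
                          FirstPhase (y ∷ ys) us → NoNeighbours (y ∷ ys ++ us)
firstPhase-noNeighbours y ys apart [] _ = subst NoNeighbours (sym (++-identityʳ (y ∷ ys))) apart
firstPhase-noNeighbours y ys {x ∷ us} apart (p ∷ q) (more ¬dom ph) =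
  subst NoNeighbours (∷ʳ-++ (y ∷ ys) x us) (firstPhase-noNeighbours y (ys ∷ʳ x) apart′ q ph)
  where
  far : ∀ {w} → w ∈ y ∷ ys → ¬ Near (toℕ x) (toℕ w)
  far = politeStep-apart y ys ¬dom p
  near-suc : ∀ {j k} → j ≡ suc k → Near j k
  near-suc refl = ≤-refl , ≤-trans (n≤1+n _) (n≤1+n _)
  apart′ : NoNeighbours (y ∷ ys ∷ʳ x)
  apart′ {v} {w} v∈ w∈ v≡1+w with ∈-++⁻ (y ∷ ys) v∈ | ∈-++⁻ (y ∷ ys) w∈
  ... | inj₁ v∈ˡ         | inj₁ w∈ˡ         = apart v∈ˡ w∈ˡ v≡1+w
  ... | inj₁ v∈ˡ         | inj₂ (here refl) = far v∈ˡ (near-sym (near-suc v≡1+w))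
  ... | inj₂ (here refl) | inj₁ w∈ˡ         = far w∈ˡ (near-suc v≡1+w)
  ... | inj₂ (here refl) | inj₂ (here refl) = 1+n≢n (sym v≡1+w)

firstPhase-branching : ∀ (y : Fin n) ys {us} → FirstPhase (y ∷ ys) us →
                       branching (y ∷ ys) us ≤ pyramid (length (y ∷ ys)) (length us)
firstPhase-branching y ys (done _) = ≤-refl
firstPhase-branching y ys {x ∷ us} ph@(more ¬dom ph′) = *-mono-≤
  -- The arriving `x` belongs to the persons still to come, which accounts for the `suc r` in
  -- `pyramid`.
  (⊓-glb (choices≤2*occupied y ys) (choices≤2*remaining y ys (x ∷ us) ¬dom (firstPhase-dominating ph)))
  (subst (λ t → branching (y ∷ ys ∷ʳ x) us ≤ pyramid t (length us)) (length-∷ʳ (y ∷ ys) x)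
    (firstPhase-branching y (ys ∷ʳ x) ph′))

unique-++⁻ˡ : ∀ (xs : List A) {ys} → Unique (xs ++ ys) → Unique xs
unique-++⁻ˡ []       _          = []
unique-++⁻ˡ (x ∷ xs) (x∉ ∷ xs!) = AllP.++⁻ˡ xs x∉ ∷ unique-++⁻ˡ xs xs!

-- As `occ ++ xs` fills the row, the number of empty places equals the number of persons still to
-- come. It bounds the choices of the next person and drops by one with each arrival.
branching≤! : ∀ (occ xs : List (Fin n)) → Unique (occ ++ xs) → n ≤ length (occ ++ xs) →
              branching occ xs ≤ length xs !
branching≤! occ []       _    _ = ≤-refl
branching≤! {n} occ (x ∷ xs) all! n≤ = *-mono-≤
  (+-cancelʳ-≤ (length occ) (choices occ) (length (x ∷ xs)) (begin
    choices occ + length occ             ≤⟨ choices+occupied≤n (unique-++⁻ˡ occ all!) ⟩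
    n                                    ≤⟨ n≤ ⟩
    length (occ ++ x ∷ xs)               ≡⟨ length-++ occ ⟩
    length occ + length (x ∷ xs)         ≡⟨ +-comm (length occ) _ ⟩
    length (x ∷ xs) + length occ         ∎))
  (branching≤! (occ ∷ʳ x) xs (subst Unique (sym (∷ʳ-++ occ x xs)) all!)
    (subst (λ zs → n ≤ length zs) (sym (∷ʳ-++ occ x xs)) n≤))
  where open ≤-Reasoning

unique⇒full : {xs : List (Fin n)} → Unique xs → n ≤ length xs → ∀ x → x ∈ xs
unique⇒full {n} {xs} xs! n≤ x with _∈?_ _≟_ x xs
... | yes x∈ = x∈
... | no  x∉ = contradiction (begin-strict
  length xs            <⟨ unique-⊆⇒length-≤ {ys = allFin n} (AllP.¬Any⇒All¬ xs x∉ ∷ xs!) (λ {z} _ → ∈-allFin z) ⟩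
  length (allFin n)    ≡⟨ length-tabulate id ⟩
  n                    ≤⟨ n≤ ⟩
  length xs            ∎) (<-irrefl refl)
  where open ≤-Reasoning

-- The bound for a fixed first place

-- This is the summand for i = j + 1, in a shape that agrees with the theorem by computation.
firstPlaceTerm : ℕ → ℕ → ℕ
firstPlaceTerm n j = (⌈2 j /3⌉ + ⌈2 (n ∸ suc j) /3⌉) ! * (n ∸ ⌈2 j /3⌉ ∸ ⌈2 (n ∸ suc j) /3⌉) !

-- Adding k = ⌈2k/3⌉ + ⌊k/3⌋ for both sides of the first place gives n = c + c′ + b, so the two
-- factorials merely exchange roles.
firstPlaceTerm≡ : ∀ {n j} → j < n → let b = suc (j / 3 + (n ∸ suc j) / 3) in b ! * (n ∸ b) ! ≡ firstPlaceTerm n j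
firstPlaceTerm≡ {n} {j} j<n = begin
  b ! * (n ∸ b) !                ≡⟨ cong (λ m → b ! * m !) (trans (cong (_∸ b) n≡) (m+n∸n≡m (c + c′) b)) ⟩
  b ! * (c + c′) !               ≡⟨ *-comm (b !) _ ⟩
  (c + c′) ! * b !               ≡⟨ cong (λ m → (c + c′) ! * m !) (trans (cong (_∸ (c + c′)) n≡) (m+n∸m≡n (c + c′) b)) ⟨
  (c + c′) ! * (n ∸ (c + c′)) !  ≡⟨ cong (λ m → (c + c′) ! * m !) (∸-+-assoc n c c′) ⟨
  firstPlaceTerm n j                       ∎
  where
  open ≡-Reasoning
  k = n ∸ suc j
  c = ⌈2 j /3⌉
  c′ = ⌈2 k /3⌉
  b = suc (j / 3 + k / 3)
  n≡ : n ≡ c + c′ + b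
  n≡ = begin
    n                                  ≡⟨ m+[n∸m]≡n j<n ⟨
    suc (j + k)                        ≡⟨ cong₂ (λ j k → suc (j + k)) (⌈2k/3⌉+k/3≡k j) (⌈2k/3⌉+k/3≡k k) ⟨
    suc (c + j / 3 + (c′ + k / 3))     ≡⟨ solve 4 (λ c q c′ q′ → con 1 :+ (c :+ q :+ (c′ :+ q′)) := c :+ c′ :+ (con 1 :+ (q :+ q′))) refl c (j / 3) c′ (k / 3) ⟩
    c + c′ + b                         ∎
    where open +-*-Solver

branching≤firstPlaceTerm : ∀ (x : Fin n) xs → n ≡ length (x ∷ xs) → PoliteFrom [ x ] xs →
                 branching [ x ] xs ≤ firstPlaceTerm n (toℕ x)
branching≤firstPlaceTerm {n} x xs n≡ polite
  with all! ← politeFrom-unique ([] ∷ []) polite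
  -- In the end all places are occupied, so domination is reached at some moment and the split
  -- exists.
  with us , vs , refl , ph ← firstPhase-split [ x ] xs
         (λ z → z , unique⇒full all! (≤-reflexive n≡) z , near-refl (toℕ z)) = begin
  branching [ x ] (us ++ vs)
    ≡⟨ branching-++ [ x ] us vs ⟩
  branching [ x ] us * branching (x ∷ us) vs
    ≤⟨ *-mono-≤ (firstPhase-branching x [] ph) (branching≤! (x ∷ us) vs all! (≤-reflexive n≡)) ⟩
  pyramid 1 (length us) * length vs !
    ≤⟨ *-monoˡ-≤ (length vs !) (pyramid≤! (length us)) ⟩
  s ! * length vs !
    ≡⟨ cong (λ m → s ! * m !) |vs|≡ ⟩
  s ! * (n ∸ s) !
    ≤⟨ factorials-antitone s (dominating⇒length≥ (firstPhase-dominating ph) (here refl)) 2s≤1+n ⟩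
  b ! * (n ∸ b) !
    ≡⟨ firstPlaceTerm≡ (toℕ<n x) ⟩
  firstPlaceTerm n (toℕ x) ∎
  where
  open ≤-Reasoning
  s = length (x ∷ us)
  b = suc (toℕ x / 3 + (n ∸ suc (toℕ x)) / 3)
  polite-us = politeFrom-++⁻ˡ us polite
  |vs|≡ : length vs ≡ n ∸ s
  |vs|≡ = sym (trans (cong (_∸ s) (trans n≡ (length-++ (x ∷ us)))) (m+n∸m≡n s (length vs)))
  2s≤1+n : 2 * s ≤ suc n
  2s≤1+n = noNeighbours⇒2*length≤ (politeFrom-unique ([] ∷ []) polite-us)
    (firstPhase-noNeighbours x [] (λ where (here refl) (here refl) eq → 1+n≢n (sym eq)) polite-us ph)

-- Counting polite sequences

politeFrom-head : ∀ {occ : List (Fin n)} {x xs} → PoliteFrom occ (x ∷ xs) → PoliteStep occ x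
politeFrom-head (p ∷ _) = p

politeFrom-tail : ∀ {occ : List (Fin n)} {x xs} → PoliteFrom occ (x ∷ xs) → PoliteFrom (occ ∷ʳ x) xs
politeFrom-tail (_ ∷ q) = q

-- The leaves of a finite tree number at most the maximum over all paths of the product of the
-- branching numbers on the path; the weight w accounts for the steps already made.
count≤ : ∀ k (occ : List (Fin n)) {Q : Pred (Vec (Fin n) k) 0ℓ} (Q? : Decidable Q) →
         (∀ xs → Q xs → PoliteFrom occ (toList xs)) → ∀ w K →
         (∀ xs → length xs ≡ k → PoliteFrom occ xs → w * branching occ xs ≤ K) →
         w * length (filter Q? (sequences n k)) ≤ K
count≤ zero occ Q? sound w K bound with Q? []
... | yes _ = bound [] refl []
... | no  _ = ≤-trans (≤-reflexive (*-zeroʳ w)) z≤n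
count≤ {n} (suc k) occ {Q} Q? sound w K bound =
  subst (λ m → w * m ≤ K) (sym (length-filter-product Q? _∷_ (allFin n) (sequences n k)))
    (total (choices occ) refl)
  where
  leaves : Fin n → ℕ
  leaves x = length (filter (λ xs → Q? (x ∷ xs)) (sequences n k))

  none : ∀ x → ¬ PoliteStep occ x → leaves x ≡ 0
  none x ¬p = cong length (filter-none (λ xs → Q? (x ∷ xs)) {xs = sequences n k}
    (All.tabulate λ {xs} _ q → ¬p (politeFrom-head (sound (x ∷ xs) q))))

  some : ∀ x → PoliteStep occ x → w * choices occ * leaves x ≤ K
  -- The factor of this step moves from the branching product into the weight of the subtree.
  some x p = count≤ k (occ ∷ʳ x) (λ xs → Q? (x ∷ xs)) (λ xs q → politeFrom-tail (sound (x ∷ xs) q))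
    (w * choices occ) K
    λ xs |xs| q → ≤-trans (≤-reflexive (*-assoc w (choices occ) _)) (bound (x ∷ xs) (cong suc |xs|) (p ∷ q))

  -- The number of candidates is a variable so that it can be split: a positive number can be
  -- cancelled, while without candidates the bound `choices occ * K` is 0.
  total : ∀ c → c ≡ choices occ → w * sum (map leaves (allFin n)) ≤ K
  total zero c≡ = ≤-trans (sum-filter-≤ (politeStep? occ) leaves w K absurd none (allFin n))
    (subst (λ m → m * K ≤ K) c≡ z≤n)
    where
    absurd : ∀ x → PoliteStep occ x → w * leaves x ≤ K
    absurd x p = contradiction (∈-length (∈-filter⁺ (politeStep? occ) (∈-allFin x) p)) (<-irrefl c≡)
  total (suc c) c≡ = *-cancelˡ-≤ (suc c) (begin
    suc c * (w * leavesSum)        ≡⟨ x∙yz≈yx∙z (suc c) w leavesSum ⟩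
    w * suc c * leavesSum          ≡⟨ cong (λ m → w * m * leavesSum) c≡ ⟩
    w * choices occ * leavesSum    ≤⟨ sum-filter-≤ (politeStep? occ) leaves (w * choices occ) K some none (allFin n) ⟩
    choices occ * K                ≡⟨ cong (_* K) c≡ ⟨
    suc c * K                      ∎)
    where
    open ≤-Reasoning
    open import Algebra.Properties.CommutativeSemigroup *-commutativeSemigroup using (x∙yz≈yx∙z)
    leavesSum = sum (map leaves (allFin n))

-- The prefix `occ` is general for the sake of the induction; for `occ` empty and full length the
-- hypothesis is `Polite`.
politeSteps⇒politeFrom : ∀ {k} (occ : List (Fin n)) (xs : Vec (Fin n) k) →
  (∀ t → PoliteStep (occ ++ take (toℕ t) (toList xs)) (lookup xs t)) → PoliteFrom occ (toList xs)
politeSteps⇒politeFrom occ []       _     = []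
politeSteps⇒politeFrom occ (x ∷ xs) steps =
  subst (λ o → PoliteStep o x) (++-identityʳ occ) (steps zero) ∷
  politeSteps⇒politeFrom (occ ∷ʳ x) xs λ t →
    subst (λ o → PoliteStep o (lookup xs t)) (sym (∷ʳ-++ occ x (take (toℕ t) (toList xs)))) (steps (suc t))

mainTheorem3 : ∀ (n : ℕ) → 1 ≤ n →
    a n ≤ ∑₁ n (λ i → (⌈2 (i ∸ 1) /3⌉ + ⌈2 (n ∸ i) /3⌉) ! * (n ∸ ⌈2 (i ∸ 1) /3⌉ ∸ ⌈2 (n ∸ i) /3⌉) !)
mainTheorem3 n@(suc k) _ = begin
  a n                                    ≡⟨ length-filter-product polite? _∷_ (allFin n) (sequences n k) ⟩
  sum (map startingAt (allFin n))        ≤⟨ sum-map-mono startingAt≤ (allFin n) ⟩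
  sum (map (firstPlaceTerm n ∘ toℕ) (allFin n))    ≡⟨ cong sum (map-toℕ-allFin (firstPlaceTerm n) n) ⟩
  sum (applyUpTo (firstPlaceTerm n) n)             ∎
  where
  open ≤-Reasoning
  startingAt : Fin n → ℕ
  startingAt x = length (filter (λ xs → polite? (x ∷ xs)) (sequences n k))
  startingAt≤ : ∀ x → startingAt x ≤ firstPlaceTerm n (toℕ x)
  startingAt≤ x = subst (_≤ firstPlaceTerm n (toℕ x)) (*-identityˡ _)
    -- The free choice of the first person is accounted for by the sum over `x`, so the weight
    -- starts at 1 with `x` already seated.
    (count≤ k [ x ] (λ xs → polite? (x ∷ xs))
      (λ xs p → politeFrom-tail (politeSteps⇒politeFrom [] (x ∷ xs) p)) 1 (firstPlaceTerm n (toℕ x))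
      λ xs |xs| p → subst (_≤ firstPlaceTerm n (toℕ x)) (sym (*-identityˡ _)) (branching≤firstPlaceTerm x xs (cong suc (sym |xs|)) p))
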